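{- Let $L=\{E\}$ be the language of (finite, undirected, loopless) graphs. The following properties are all regular: $\phi_{\rm none}(x)$: "$x$ is an isolated node", i.e. $(\forall y)\neg(xEy)$; $\phi_{\rm all}(x)$: "$x$ is adjacent to every other node", i.e. $(\forall y)(y\neq x\rightarrow xEy)$; and, for every $k\geq 1$, $\phi_k(x)$: "$x$ is adjacent to exactly $k$ nodes".
   Context: $L$-structures are graphs $G=\langle A,E\rangle$ with $E$ a symmetric irreflexive binary relation on $A$; $\mathbf{S}_n(L)$ is the set of all such graphs with node set $\{1,\ldots,n\}$, so $|\mathbf{S}_n(L)|=2^{\binom{n}{2}}$. For a first-order formula $\phi(x)$ of $L$ with one free variable and a graph $G$ with node set $A$, $\phi(G)=\{a\in A:G\models\phi(a)\}$. Let $\mathbf{S}_{2n}(\phi:\mathrm{ntr})=\{G\in\mathbf{S}_{2n}(L):|\phi(G)|=n\}$, $d_{2n}(\phi:\mathrm{ntr})=|\mathbf{S}_{2n}(\phi:\mathrm{ntr})|/|\mathbf{S}_{2n}(L)|$, and $d(\phi:\mathrm{ntr})=\lim_{n\to\infty}d_{2n}(\phi:\mathrm{ntr})$ whenever this limit exists. The property $\phi(x)$ is regular if $d(\phi:\mathrm{ntr})=0$. -}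

module Defs where

open import Data.Bool using (Bool; true; false; T)
open import Data.Bool.Properties using (T?)
open import Data.Empty using (⊥; ⊥-elim)
open import Data.Fin using (Fin; zero; suc; _↑ˡ_; _↑ʳ_; inject; toℕ)
open import Data.Fin.Properties using (all?; any?) renaming (_≟_ to _≟ᶠ_)
open import Data.Integer using (+_)
open import Data.List using (List; []; _∷_; length; filter; allFin; cartesianProductWith)
open import Data.List.Membership.Propositional using (_∈_)
open import Data.List.Membership.Propositional.Properties
  using (∈-cartesianProductWith⁺; ∈-filter⁺; ∈-length)
open import Data.List.Relation.Unary.All using ([]; _∷_)
open import Data.List.Relation.Unary.Any using (here; there)
open import Data.List.Relation.Unary.AllPairs using ([]; _∷_)
open import Data.List.Relation.Unary.Unique.Propositional using (Unique)
open import Data.List.Relation.Unary.Unique.Propositional.Properties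
  using (cartesianProductWith⁺; filter⁺)
open import Data.Nat using (ℕ; zero; suc; _+_; _*_; _≥_; NonZero; >-nonZero) renaming (_≟_ to _≟ⁿ_)
open import Data.Product using (_×_; _,_; ∃; ∃-syntax)
open import Data.Rational using (ℚ; 0ℚ; _<_; _-_; ∣_∣; _/_)
open import Data.Sum using (_⊎_)
open import Data.Unit using (⊤; tt)
open import Data.Vec using (Vec; []; _∷_; lookup; replicate)
open import Data.Vec.Functional using (foldr)
open import Data.Vec.Properties using (∷-injective; lookup-replicate)
open import Relation.Binary using (Rel; Symmetric; Irreflexive)
open import Relation.Binary.PropositionalEquality using (_≡_; refl; subst; cong; trans)
open import Relation.Nullary using (¬_; Dec; yes; no)
open import Relation.Nullary.Decidable using (map′; ¬?; _×-dec_; _⊎-dec_; _→-dec_)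

------------------------------------------------------------------------
-- First-order formulas of L = {E} (with equality)

-- Variables are de Bruijn indices: a `Formula m` has its free variables
-- among the m indices, and a quantifier binds index 0.

infix  8 _≐_ _E_
infixr 7 _∧′_
infixr 6 _∨′_
infixr 5 _⇒′_

data Formula (m : ℕ) : Set where
  _≐_ _E_            : Fin m → Fin m → Formula m
  ⊤′ ⊥′              : Formula m
  ¬′_                : Formula m → Formula m
  _∧′_ _∨′_ _⇒′_     : Formula m → Formula m → Formula m
  ∀′_ ∃′_            : Formula (suc m) → Formula m

⋀ ⋁ : ∀ {k m} → (Fin k → Formula m) → Formula m
⋀ = foldr _∧′_ ⊤′
⋁ = foldr _∨′_ ⊥′

∃^ : ∀ k {m} → Formula (k + m) → Formula m
∃^ zero    φ = φ
∃^ (suc k) φ = ∃^ k (∃′ φ)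

------------------------------------------------------------------------
-- L-structures on a finite node set and satisfaction

-- A binary relation on the node set Fin n (standing for {1,…,n}), given by
-- its table, so that propositional equality is equality of relations.
Structure : ℕ → Set
Structure n = Vec (Vec Bool n) n

Edge : ∀ {n} → Structure n → Rel (Fin n) _
Edge G a b = T (lookup (lookup G a) b)

infix 4 _⊨_[_] _⊨?_[_]

_⊨_[_] : ∀ {n m} → Structure n → Formula m → Vec (Fin n) m → Set
G ⊨ x ≐ y  [ ρ ] = lookup ρ x ≡ lookup ρ y
G ⊨ x E y  [ ρ ] = Edge G (lookup ρ x) (lookup ρ y)
G ⊨ ⊤′     [ ρ ] = ⊤
G ⊨ ⊥′     [ ρ ] = ⊥
G ⊨ ¬′ φ   [ ρ ] = ¬ G ⊨ φ [ ρ ]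
G ⊨ φ ∧′ ψ [ ρ ] = G ⊨ φ [ ρ ] × G ⊨ ψ [ ρ ]
G ⊨ φ ∨′ ψ [ ρ ] = G ⊨ φ [ ρ ] ⊎ G ⊨ ψ [ ρ ]
G ⊨ φ ⇒′ ψ [ ρ ] = G ⊨ φ [ ρ ] → G ⊨ ψ [ ρ ]
G ⊨ ∀′ φ   [ ρ ] = ∀ a → G ⊨ φ [ a ∷ ρ ]
G ⊨ ∃′ φ   [ ρ ] = ∃[ a ] G ⊨ φ [ a ∷ ρ ]

_⊨?_[_] : ∀ {n m} (G : Structure n) (φ : Formula m) ρ → Dec (G ⊨ φ [ ρ ])
G ⊨? x ≐ y  [ ρ ] = lookup ρ x ≟ᶠ lookup ρ y
G ⊨? x E y  [ ρ ] = T? _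
G ⊨? ⊤′     [ ρ ] = yes tt
G ⊨? ⊥′     [ ρ ] = no λ ()
G ⊨? ¬′ φ   [ ρ ] = ¬? (G ⊨? φ [ ρ ])
G ⊨? φ ∧′ ψ [ ρ ] = (G ⊨? φ [ ρ ]) ×-dec (G ⊨? ψ [ ρ ])
G ⊨? φ ∨′ ψ [ ρ ] = (G ⊨? φ [ ρ ]) ⊎-dec (G ⊨? ψ [ ρ ])
G ⊨? φ ⇒′ ψ [ ρ ] = (G ⊨? φ [ ρ ]) →-dec (G ⊨? ψ [ ρ ])
G ⊨? ∀′ φ   [ ρ ] = all? λ a → G ⊨? φ [ a ∷ ρ ]
G ⊨? ∃′ φ   [ ρ ] = any? λ a → G ⊨? φ [ a ∷ ρ ]

-- φ(G), as a duplicate-free list.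
⟦_⟧ : ∀ {n} → Formula 1 → Structure n → List (Fin n)
⟦ φ ⟧ G = filter (λ a → G ⊨? φ [ a ∷ [] ]) (allFin _)

------------------------------------------------------------------------
-- Graphs

IsGraph : ∀ {n} → Structure n → Set
IsGraph G = Symmetric (Edge G) × Irreflexive _≡_ (Edge G)

isGraph? : ∀ {n} (G : Structure n) → Dec (IsGraph G)
isGraph? G = symmetric? ×-dec irreflexive?
  where
  edge? : ∀ a b → Dec (Edge G a b)
  edge? a b = T? _

  symmetric? : Dec (Symmetric (Edge G))
  symmetric? = map′ (λ s {a} {b} → s a b) (λ s a b → s {a} {b})
    (all? λ a → all? λ b → edge? a b →-dec edge? b a)

  irreflexive? : Dec (Irreflexive _≡_ (Edge G))
  irreflexive? = map′ (λ { i {a} refl → i a }) (λ i a → i refl)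
    (all? λ a → ¬? (edge? a a))

vectors : ∀ {A : Set} → List A → ∀ n → List (Vec A n)
vectors xs zero    = [] ∷ []
vectors xs (suc n) = cartesianProductWith _∷_ xs (vectors xs n)

structures : ∀ n → List (Structure n)
structures n = vectors (vectors (true ∷ false ∷ []) n) n

-- The set S_n(L) of all graphs on {1,…,n}; `∈-graphs` and `graphs-unique`
-- show that every graph is listed exactly once.
graphs : ∀ n → List (Structure n)
graphs n = filter isGraph? (structures n)

∈-vectors : ∀ {A : Set} {xs : List A} → (∀ x → x ∈ xs) → ∀ {n} (v : Vec A n) → v ∈ vectors xs n
∈-vectors all []      = here refl
∈-vectors all (x ∷ v) = ∈-cartesianProductWith⁺ _∷_ (all x) (∈-vectors all v)

vectors-unique : ∀ {A : Set} {xs : List A} → Unique xs → ∀ n → Unique (vectors xs n)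
vectors-unique u zero    = [] ∷ []
vectors-unique u (suc n) = cartesianProductWith⁺ _∷_ ∷-injective u (vectors-unique u n)

∈-structures : ∀ {n} (G : Structure n) → G ∈ structures n
∈-structures = ∈-vectors (∈-vectors λ { true → here refl ; false → there (here refl) })

∈-graphs : ∀ {n} {G : Structure n} → IsGraph G → G ∈ graphs n
∈-graphs g = ∈-filter⁺ isGraph? (∈-structures _) g

graphs-unique : ∀ n → Unique (graphs n)
graphs-unique n = filter⁺ isGraph?
  (vectors-unique (vectors-unique (((λ ()) ∷ []) ∷ [] ∷ []) n) n)

edgeless : ∀ n → Structure n
edgeless n = replicate n (replicate n false)

edgeless-noEdge : ∀ {n} (a b : Fin n) → ¬ Edge (edgeless n) a b
edgeless-noEdge {n} a b = subst T
  (trans (cong (λ r → lookup r b) (lookup-replicate a (replicate n false)))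
         (lookup-replicate b false))

edgeless-isGraph : ∀ n → IsGraph (edgeless n)
edgeless-isGraph n = (λ {a} {b} e → ⊥-elim (edgeless-noEdge a b e))
                   , (λ {a} {b} _ → edgeless-noEdge a b)

graphs-nonZero : ∀ n → NonZero (length (graphs n))
graphs-nonZero n = >-nonZero (∈-length (∈-graphs {G = edgeless n} (edgeless-isGraph n)))

------------------------------------------------------------------------
-- Densities and regularity

-- S_{2n}(φ:ntr)
ntr : Formula 1 → ∀ n → List (Structure (2 * n))
ntr φ n = filter (λ G → length (⟦ φ ⟧ G) ≟ⁿ n) (graphs (2 * n))

-- d_{2n}(φ:ntr)
density : Formula 1 → ℕ → ℚ
density φ n = + length (ntr φ n) / length (graphs (2 * n))
  where instance nonZero = graphs-nonZero (2 * n)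

infix 4 _⟶_

_⟶_ : (ℕ → ℚ) → ℚ → Set
s ⟶ l = ∀ ε → 0ℚ < ε → ∃[ N ] (∀ n → n ≥ N → ∣ s n - l ∣ < ε)

Regular : Formula 1 → Set
Regular φ = density φ ⟶ 0ℚ

------------------------------------------------------------------------
-- The properties

φ-none : Formula 1
φ-none = ∀′ (¬′ (x E y))
  where
  y = zero
  x = suc zero

φ-all : Formula 1
φ-all = ∀′ (¬′ (y ≐ x) ⇒′ x E y)
  where
  y = zero
  x = suc zero

-- ∃ y₁ … y_k, pairwise distinct and adjacent to x, such that every z
-- adjacent to x is one of them.  `inject j` runs over the indices below i.
φ-exactly : ℕ → Formula 1
φ-exactly k = ∃^ k
  (  ⋀ (λ i → ⋀ (λ (j : Fin (toℕ i)) → ¬′ (y i ≐ y (inject j))))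
  ∧′ ⋀ (λ i → x E y i)
  ∧′ ∀′ (suc x E zero ⇒′ ⋁ (λ i → zero ≐ suc (y i))))
  where
  y : Fin k → Fin (k + 1)
  y i = i ↑ˡ 1

  x : Fin (k + 1)
  x = k ↑ʳ zero

{-# OPTIONS --safe #-}

-- Each of the three properties φ bounds one side of the adjacency of a node:
-- a node a satisfying φ has at most k neighbours, or at most k non-neighbours
-- (k being fixed).  Take triples (G , a , b) with G in S_{2n}(φ : ntr), a in
-- φ(G) and b on the other, unbounded side of a, and toggle the pair ab.  There
-- are at least |S_{2n}(φ : ntr)| · n · (2n − k − 1) such triples.  The toggled
-- graph, with a, determines b up to k + 1 choices: any two choices are both on
-- the bounded side of a, and undoing one of them leaves the other there.
-- Hence d_{2n}(φ : ntr) ≤ 2 (k + 1) / (2n − k − 1).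

module Submission where

open import Defs
open import Data.Bool using (Bool; true; false; T; not; _∧_; _∨_; _xor_)
open import Data.Bool.Properties
  using (∧-comm; ∨-comm; ∧-zeroʳ; xor-same; xor-assoc; T-≡)
  renaming (_≟_ to _≟ᵇ_)
open import Data.Empty using (⊥-elim)
open import Data.Fin using (Fin; zero; suc; _↑ʳ_)
open import Data.Fin.Properties using () renaming (_≟_ to _≟ᶠ_)
open import Data.Integer using (+_; -[1+_]; +<+) renaming (_<_ to _<ℤ_)
open import Data.Integer.Properties using (pos-*)
open import Data.List using (List; []; _∷_; _++_; length; map; filter; allFin; cartesianProduct)
open import Data.List.Properties using (length-++; length-map; length-tabulate)
open import Data.List.Membership.Propositional using (_∈_)
open import Data.List.Membership.Propositional.Properties
  using (∈-∃++; ∈-++⁺ˡ; ∈-++⁺ʳ; ∈-++⁻; ∈-map⁺; ∈-map⁻; ∈-filter⁺; ∈-filter⁻; ∈-allFin; ∈-cartesianProduct⁺)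
open import Data.List.Relation.Binary.Subset.Propositional using (_⊆_)
import Data.List.Relation.Unary.All as All
open import Data.List.Relation.Unary.Any using (here; there)
open import Data.List.Relation.Unary.AllPairs using ([]; _∷_)
open import Data.List.Relation.Unary.Unique.Propositional using (Unique)
import Data.List.Relation.Unary.Unique.Propositional.Properties as Unique
open import Data.Nat using (ℕ; zero; suc; _+_; _*_; _≤_; _<_; z≤n; s≤s; z<s; NonZero; >-nonZero)
  renaming (_≟_ to _≟ⁿ_)
open import Data.Nat.Properties
  using (module ≤-Reasoning; ≤-trans; ≤-reflexive; +-mono-≤; +-monoˡ-≤; +-suc;
         *-monoˡ-≤; *-cancelˡ-≤; *-cancelʳ-<; +-cancelˡ-≤; m≤m+n; m≤n+m)
open import Data.Nat.Solver using (module +-*-Solver)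
open import Data.Product using (_×_; _,_; ∃-syntax; proj₁; proj₂)
open import Data.Rational using (0ℚ; mkℚ; ↧ₙ_; _-_; ∣_∣; _/_) renaming (_<_ to _<ℚ_; *<* to *<*ℚ)
import Data.Rational.Properties as ℚ
open import Data.Rational.Unnormalised using (mkℚᵘ; *<*)
import Data.Rational.Unnormalised.Properties as ℚᵘ
open import Data.Sum using (inj₁; inj₂)
open import Data.Vec using (Vec; []; _∷_; lookup; tabulate; toList) renaming (_++_ to _++ᵛ_)
import Data.Vec.Properties as Vec
open import Data.Vec.Membership.Propositional.Properties using (∈-lookup; ∈-toList⁺)
open import Function using (_∘_)
open import Function.Bundles using (Equivalence)
open import Relation.Binary.PropositionalEquality
open import Relation.Nullary using (¬_; Dec; yes; no; does; contradiction)
open import Relation.Nullary.Decidable using (¬?; _×-dec_; dec-true; dec-false)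

private variable
  A B : Set
  k n : ℕ

-- Counting with duplicate-free lists

-- Pigeonhole by induction: cut one occurrence of the head `x` out of `ys`. The tail avoids `x`, so
-- it still embeds in what is left.
unique⇒length≤ : {xs ys : List A} → Unique xs → xs ⊆ ys → length xs ≤ length ys
unique⇒length≤ [] _ = z≤n
unique⇒length≤ {xs = x ∷ xs} (x∉xs ∷ u) sub with ∈-∃++ (sub (here refl))
... | as , bs , refl = begin
  suc (length xs)             ≤⟨ s≤s (unique⇒length≤ u sub′) ⟩
  suc (length (as ++ bs))     ≡⟨ cong suc (length-++ as) ⟩
  suc (length as + length bs) ≡⟨ +-suc (length as) (length bs) ⟨
  length as + suc (length bs) ≡⟨ length-++ as ⟨
  length (as ++ x ∷ bs)       ∎
  where
  open ≤-Reasoning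
  sub′ : xs ⊆ as ++ bs
  sub′ y∈xs with ∈-++⁻ as (sub (there y∈xs))
  ... | inj₁ y∈as           = ∈-++⁺ˡ y∈as
  ... | inj₂ (here refl)    = contradiction refl (All.lookup x∉xs y∈xs)
  ... | inj₂ (there y∈bs)   = ∈-++⁺ʳ as y∈bs

-- A dependent sum: the second list may vary with the first entry. Iterated, it yields the triples
-- of a graph and two nodes.
pairs : List A → (A → List B) → List (A × B)
pairs []       f = []
pairs (x ∷ xs) f = map (x ,_) (f x) ++ pairs xs f

∈-pairs⁺ : ∀ {xs : List A} {f : A → List B} {x y} → x ∈ xs → y ∈ f x → (x , y) ∈ pairs xs f
∈-pairs⁺ (here refl) y∈ = ∈-++⁺ˡ (∈-map⁺ _ y∈)
∈-pairs⁺ (there x∈)  y∈ = ∈-++⁺ʳ _ (∈-pairs⁺ x∈ y∈)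

∈-pairs⁻ : ∀ (xs : List A) {f : A → List B} {x y} → (x , y) ∈ pairs xs f → x ∈ xs × y ∈ f x
∈-pairs⁻ (x ∷ xs) {f} p with ∈-++⁻ (map (x ,_) (f x)) p
... | inj₁ q with _ , y∈ , refl ← ∈-map⁻ (x ,_) q = here refl , y∈
... | inj₂ q with x∈ , y∈ ← ∈-pairs⁻ xs q = there x∈ , y∈

pairs-unique : ∀ {xs : List A} {f : A → List B} →
               Unique xs → (∀ x → Unique (f x)) → Unique (pairs xs f)
pairs-unique []                     uf = []
pairs-unique {xs = x ∷ xs} (x∉xs ∷ u) uf =
  Unique.++⁺ (Unique.map⁺ (cong proj₂) (uf x)) (pairs-unique u uf) disjoint
  where
  disjoint : ∀ {z} → ¬ (z ∈ map (x ,_) _ × z ∈ pairs xs _)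
  disjoint (p , q) with _ , _ , refl ← ∈-map⁻ (x ,_) p =
    All.lookup x∉xs (proj₁ (∈-pairs⁻ xs q)) refl

length-pairs-cons : ∀ (x : A) xs (f : A → List B) →
                    length (pairs (x ∷ xs) f) ≡ length (f x) + length (pairs xs f)
length-pairs-cons x xs f =
  trans (length-++ (map (x ,_) (f x))) (cong (_+ _) (length-map (x ,_) (f x)))

length-pairs-≥ : ∀ (xs : List A) (f : A → List B) {m} → (∀ {x} → x ∈ xs → m ≤ length (f x)) →
                 length xs * m ≤ length (pairs xs f)
length-pairs-≥ []       f h = z≤n
length-pairs-≥ (x ∷ xs) f h =
  ≤-trans (+-mono-≤ (h (here refl)) (length-pairs-≥ xs f (h ∘ there)))
          (≤-reflexive (sym (length-pairs-cons x xs f)))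

length-pairs-≤ : ∀ (xs : List A) (f : A → List B) {m} → (∀ x → length (f x) ≤ m) →
                 length (pairs xs f) ≤ length xs * m
length-pairs-≤ []       f h = z≤n
length-pairs-≤ (x ∷ xs) f h =
  ≤-trans (≤-reflexive (length-pairs-cons x xs f)) (+-mono-≤ (h x) (length-pairs-≤ xs f h))

length-cartesianProduct : ∀ (xs : List A) (ys : List B) →
                          length (cartesianProduct xs ys) ≡ length xs * length ys
length-cartesianProduct []       ys = refl
length-cartesianProduct (x ∷ xs) ys =
  trans (length-++ (map (x ,_) ys)) (cong₂ _+_ (length-map (x ,_) ys) (length-cartesianProduct xs ys))

length-allFin : ∀ n → length (allFin n) ≡ n
length-allFin n = length-tabulate {n = n} (λ i → i)

-- Toggling one pair of nodes

adj : Structure n → Fin n → Fin n → Bool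
adj G a b = lookup (lookup G a) b

lookup-ext : {xs ys : Vec A n} → (∀ i → lookup xs i ≡ lookup ys i) → xs ≡ ys
lookup-ext {xs = xs} {ys} h = begin
  xs                   ≡⟨ Vec.tabulate∘lookup xs ⟨
  tabulate (lookup xs) ≡⟨ Vec.tabulate-cong h ⟩
  tabulate (lookup ys) ≡⟨ Vec.tabulate∘lookup ys ⟩
  ys                   ∎
  where open ≡-Reasoning

adj-ext : {G H : Structure n} → (∀ a b → adj G a b ≡ adj H a b) → G ≡ H
adj-ext h = lookup-ext λ a → lookup-ext (h a)

-- Indicator of the unordered pair of `a` and `b`. Covering both orders keeps a toggled relation
-- symmetric.
link : (a b i j : Fin n) → Bool
link a b i j = does (i ≟ᶠ a) ∧ does (j ≟ᶠ b) ∨ does (i ≟ᶠ b) ∧ does (j ≟ᶠ a)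

link-sym : ∀ (a b i j : Fin n) → link a b i j ≡ link a b j i
link-sym a b i j = trans (∨-comm (does (i ≟ᶠ a) ∧ does (j ≟ᶠ b)) _)
  (cong₂ _∨_ (∧-comm (does (i ≟ᶠ b)) _) (∧-comm (does (i ≟ᶠ a)) _))

link-irrefl : ∀ {a b : Fin n} → b ≢ a → ∀ i → link a b i i ≡ false
link-irrefl {a = a} {b} b≢a i with i ≟ᶠ a
... | no  _    = ∧-zeroʳ _
... | yes refl rewrite dec-false (a ≟ᶠ b) (b≢a ∘ sym) = refl

link-self : ∀ (a b : Fin n) → link a b a b ≡ true
link-self a b rewrite dec-true (a ≟ᶠ a) refl | dec-true (b ≟ᶠ b) refl = refl

-- Since `b ≢ a`, the reversed order cannot match in row `a`, so the toggle changes that row only at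
-- `b`.
link-other : ∀ {a b c : Fin n} → b ≢ a → c ≢ b → link a b a c ≡ false
link-other {a = a} {b} {c} b≢a c≢b
  rewrite dec-false (c ≟ᶠ b) c≢b | dec-false (a ≟ᶠ b) (b≢a ∘ sym) | ∧-zeroʳ (does (a ≟ᶠ a)) = refl

toggle : Fin n → Fin n → Structure n → Structure n
toggle a b G = tabulate λ i → tabulate λ j → link a b i j xor adj G i j

adj-toggle : ∀ (a b : Fin n) G i j → adj (toggle a b G) i j ≡ link a b i j xor adj G i j
adj-toggle a b G i j =
  trans (cong (λ r → lookup r j) (Vec.lookup∘tabulate _ i)) (Vec.lookup∘tabulate _ j)

adj-toggle-self : ∀ (a b : Fin n) G → adj (toggle a b G) a b ≡ not (adj G a b)
adj-toggle-self a b G = trans (adj-toggle a b G a b) (cong (_xor adj G a b) (link-self a b))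

adj-toggle-other : ∀ {a b c : Fin n} G → b ≢ a → c ≢ b → adj (toggle a b G) a c ≡ adj G a c
adj-toggle-other {a = a} {b} {c} G b≢a c≢b =
  trans (adj-toggle a b G a c) (cong (_xor adj G a c) (link-other b≢a c≢b))

-- Each entry is xored twice with the same bit, which cancels.
toggle-involutive : ∀ (a b : Fin n) G → toggle a b (toggle a b G) ≡ G
toggle-involutive a b G = adj-ext λ i j → begin
  adj (toggle a b (toggle a b G)) i j             ≡⟨ adj-toggle a b (toggle a b G) i j ⟩
  link a b i j xor adj (toggle a b G) i j         ≡⟨ cong (link a b i j xor_) (adj-toggle a b G i j) ⟩
  link a b i j xor (link a b i j xor adj G i j)   ≡⟨ xor-assoc (link a b i j) _ _ ⟨
  (link a b i j xor link a b i j) xor adj G i j   ≡⟨ cong (_xor adj G i j) (xor-same (link a b i j)) ⟩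
  adj G i j                                       ∎
  where open ≡-Reasoning

toggle-isGraph : ∀ {a b : Fin n} {G} → b ≢ a → IsGraph G → IsGraph (toggle a b G)
toggle-isGraph {a = a} {b} {G} b≢a (G-sym , G-irr) =
  (λ {i} {j} → subst T (toggle-sym i j)) , λ { {i} refl → G-irr refl ∘ subst T (toggle-diag i) }
  where
  T-antisym : ∀ {x y} → (T x → T y) → (T y → T x) → x ≡ y
  T-antisym {false} {false} f g = refl
  T-antisym {false} {true}  f g = ⊥-elim (g _)
  T-antisym {true}  {false} f g = ⊥-elim (f _)
  T-antisym {true}  {true}  f g = refl

  toggle-sym : ∀ i j → adj (toggle a b G) i j ≡ adj (toggle a b G) j i
  toggle-sym i j = begin
    adj (toggle a b G) i j        ≡⟨ adj-toggle a b G i j ⟩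
    link a b i j xor adj G i j    ≡⟨ cong₂ _xor_ (link-sym a b i j) (T-antisym G-sym G-sym) ⟩
    link a b j i xor adj G j i    ≡⟨ adj-toggle a b G j i ⟨
    adj (toggle a b G) j i        ∎
    where open ≡-Reasoning

  toggle-diag : ∀ i → adj (toggle a b G) i i ≡ adj G i i
  toggle-diag i = trans (adj-toggle a b G i i) (cong (_xor adj G i i) (link-irrefl b≢a i))

-- Membership in φ(G) and in the set of graphs split evenly by φ

∈-⟦⟧⁻ : ∀ φ {G : Structure n} {a} → a ∈ ⟦ φ ⟧ G → G ⊨ φ [ a ∷ [] ]
∈-⟦⟧⁻ {n} φ {G} a∈ = proj₂ (∈-filter⁻ (λ a → G ⊨? φ [ a ∷ [] ]) {xs = allFin n} a∈)

∈-ntr⁻ : ∀ φ n {G} → G ∈ ntr φ n → IsGraph G × length (⟦ φ ⟧ G) ≡ n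
∈-ntr⁻ φ n G∈ =
  let G∈graphs , |φG|≡n = ∈-filter⁻ (λ G → length (⟦ φ ⟧ G) ≟ⁿ n) {xs = graphs (2 * n)} G∈
  in proj₂ (∈-filter⁻ isGraph? {xs = structures (2 * n)} G∈graphs) , |φG|≡n

ntr-unique : ∀ φ n → Unique (ntr φ n)
ntr-unique φ n = Unique.filter⁺ (λ G → length (⟦ φ ⟧ G) ≟ⁿ n) (graphs-unique (2 * n))

⟦⟧-unique : ∀ φ (G : Structure n) → Unique (⟦ φ ⟧ G)
⟦⟧-unique φ G = Unique.filter⁺ (λ a → G ⊨? φ [ a ∷ [] ]) (Unique.allFin⁺ _)

-- A node satisfying φ has at most k neighbours (v = false) or at most k
-- non-neighbours other than itself (v = true).
Sparse : Bool → ℕ → Formula 1 → Set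
Sparse v k φ = ∀ {n} (G : Structure n) a → G ⊨ φ [ a ∷ [] ] →
  ∃[ ys ] (length ys ≤ k × ∀ {b} → b ≢ a → adj G a b ≡ not v → b ∈ ys)

-- The double count for a sparse property

module _ {v : Bool} {k : ℕ} {φ : Formula 1} (sparse : Sparse v k φ) where

  -- The unbounded side of `a`: when `a` satisfies `φ`, all but at most `k` of the other nodes are
  -- free.
  Free : Structure n × Fin n → Fin n → Set
  Free (G , a) b = b ≢ a × adj G a b ≡ v

  free? : (p : Structure n × Fin n) (b : Fin n) → Dec (Free p b)
  free? (G , a) b = ¬? (b ≟ᶠ a) ×-dec (adj G a b ≟ᵇ v)

  free : Structure n × Fin n → List (Fin n)
  free p = filter (free? p) (allFin _)

  -- Candidates for the second node once only the toggled graph and `a` are known: it now lies on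
  -- the bounded side, and undoing its toggle restores `φ` at `a`.
  Toggled : Structure n × Fin n → Fin n → Set
  Toggled (G , a) b = b ≢ a × adj G a b ≡ not v × toggle a b G ⊨ φ [ a ∷ [] ]

  toggled? : (p : Structure n × Fin n) (b : Fin n) → Dec (Toggled p b)
  toggled? (G , a) b =
    ¬? (b ≟ᶠ a) ×-dec ((adj G a b ≟ᵇ not v) ×-dec (toggle a b G ⊨? φ [ a ∷ [] ]))

  toggled : Structure n × Fin n → List (Fin n)
  toggled p = filter (toggled? p) (allFin _)

  -- Every node is `a` itself, one of the at most `k` exceptions, or free. The `suc` accounts for
  -- `a`.
  length-free : ∀ {m} (G : Structure n) a → G ⊨ φ [ a ∷ [] ] → suc k + m ≤ n →
                m ≤ length (free (G , a))
  length-free {n} {m} G a sat k+m<n with sparse G a sat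
  ... | ys , |ys|≤k , in-ys = +-cancelˡ-≤ (suc k) _ _ (begin
    suc k + m                                       ≤⟨ k+m<n ⟩
    n                                               ≡⟨ length-allFin n ⟨
    length (allFin n)                               ≤⟨ unique⇒length≤ (Unique.allFin⁺ n) cover ⟩
    suc (length (ys ++ free (G , a)))               ≡⟨ cong suc (length-++ ys) ⟩
    suc (length ys + length (free (G , a)))         ≤⟨ s≤s (+-monoˡ-≤ _ |ys|≤k) ⟩
    suc k + length (free (G , a))                   ∎)
    where
    open ≤-Reasoning
    ≢⇒≡not : ∀ {x y} → x ≢ y → x ≡ not y
    ≢⇒≡not {false} {false} x≢y = contradiction refl x≢y
    ≢⇒≡not {false} {true}  x≢y = refl
    ≢⇒≡not {true}  {false} x≢y = refl
    ≢⇒≡not {true}  {true}  x≢y = contradiction refl x≢y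

    cover : allFin n ⊆ a ∷ ys ++ free (G , a)
    cover {b} b∈ with b ≟ᶠ a | adj G a b ≟ᵇ v
    ... | yes b≡a | _      = here b≡a
    ... | no b≢a  | yes eq = there (∈-++⁺ʳ ys (∈-filter⁺ (free? (G , a)) b∈ (b≢a , eq)))
    ... | no b≢a  | no neq = there (∈-++⁺ˡ (in-ys b≢a (≢⇒≡not neq)))

  -- Undo the toggle at one candidate `b`, so that `a` satisfies `φ`. Any other candidate `c` keeps
  -- its adjacency to `a`, hence is one of the at most `k` exceptions there; `b` itself accounts for
  -- the `suc`.
  length-toggled : (p : Structure n × Fin n) → length (toggled p) ≤ suc k
  length-toggled {n} p@(G , a) = go (toggled p) refl
    where
    unique : Unique (toggled p)
    unique = Unique.filter⁺ (toggled? p) (Unique.allFin⁺ n)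

    member : ∀ {b} → b ∈ toggled p → Toggled p b
    member b∈ = proj₂ (∈-filter⁻ (toggled? p) {xs = allFin n} b∈)

    go : ∀ bs → toggled p ≡ bs → length (toggled p) ≤ suc k
    go [] eq = subst (λ l → length l ≤ suc k) (sym eq) z≤n
    go (b ∷ bs) eq with member (subst (b ∈_) (sym eq) (here refl))
    ... | b≢a , _ , sat with sparse (toggle a b G) a sat
    ... | ys , |ys|≤k , in-ys = ≤-trans (unique⇒length≤ unique cover) (s≤s |ys|≤k)
      where
      cover : toggled p ⊆ b ∷ ys
      cover {c} c∈ with c ≟ᶠ b
      ... | yes c≡b = here c≡b
      ... | no  c≢b with c≢a , eq′ , _ ← member c∈ =
        there (in-ys c≢a (trans (adj-toggle-other G b≢a c≢b) eq′))

  -- The left side bounds from below the triples before toggling, `m` being a lower bound for the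
  -- free nodes. Toggling embeds them in the triples counted on the right.
  double-count : ∀ n {m} → suc k + m ≤ 2 * n →
    length (ntr φ n) * n * m ≤ length (graphs (2 * n)) * (2 * n) * suc k
  double-count n {m} k+m<2n = begin
    length (ntr φ n) * n * m                               ≤⟨ *-monoˡ-≤ m (length-pairs-≥ (ntr φ n) ⟦ φ ⟧ exactly-n) ⟩
    length flags * m                                       ≤⟨ length-pairs-≥ flags free many-free ⟩
    length (pairs flags free)                              ≡⟨ length-map toggle³ (pairs flags free) ⟨
    length (map toggle³ (pairs flags free))                ≤⟨ unique⇒length≤ (Unique.map⁺ toggle³-injective flags-unique) into ⟩
    length (pairs nodes toggled)                           ≤⟨ length-pairs-≤ nodes toggled length-toggled ⟩
    length nodes * suc k                                   ≡⟨ cong (_* suc k) (length-cartesianProduct (graphs (2 * n)) _) ⟩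
    length (graphs (2 * n)) * length (allFin (2 * n)) * suc k
                                                           ≡⟨ cong (λ l → length (graphs (2 * n)) * l * suc k) (length-allFin (2 * n)) ⟩
    length (graphs (2 * n)) * (2 * n) * suc k              ∎
    where
    open ≤-Reasoning
    flags nodes : List (Structure (2 * n) × Fin (2 * n))
    flags = pairs (ntr φ n) ⟦ φ ⟧
    nodes = cartesianProduct (graphs (2 * n)) (allFin (2 * n))

    toggle³ : (Structure (2 * n) × Fin (2 * n)) × Fin (2 * n) →
              (Structure (2 * n) × Fin (2 * n)) × Fin (2 * n)
    toggle³ ((G , a) , b) = (toggle a b G , a) , b

    toggle³-involutive : ∀ t → toggle³ (toggle³ t) ≡ t
    toggle³-involutive ((G , a) , b) = cong (λ H → (H , a) , b) (toggle-involutive a b G)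

    -- The triple retains `a` and `b`, so the toggle can be undone from its image.
    toggle³-injective : ∀ {s t} → toggle³ s ≡ toggle³ t → s ≡ t
    toggle³-injective {s} {t} eq =
      trans (sym (toggle³-involutive s)) (trans (cong toggle³ eq) (toggle³-involutive t))

    exactly-n : ∀ {G} → G ∈ ntr φ n → n ≤ length (⟦ φ ⟧ G)
    exactly-n G∈ = ≤-reflexive (sym (proj₂ (∈-ntr⁻ φ n G∈)))

    flag : ∀ {G a} → (G , a) ∈ flags → IsGraph G × G ⊨ φ [ a ∷ [] ]
    flag p =
      let G∈ , a∈ = ∈-pairs⁻ (ntr φ n) p
      in proj₁ (∈-ntr⁻ φ n G∈) , ∈-⟦⟧⁻ φ a∈

    many-free : ∀ {p} → p ∈ flags → m ≤ length (free p)
    many-free {G , a} p∈ = length-free G a (proj₂ (flag p∈)) k+m<2n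

    flags-unique : Unique (pairs flags free)
    flags-unique = pairs-unique
      (pairs-unique (ntr-unique φ n) (⟦⟧-unique φ))
      (λ p → Unique.filter⁺ (free? p) (Unique.allFin⁺ (2 * n)))

    toggle³-∈ : ∀ {t} → t ∈ pairs flags free → toggle³ t ∈ pairs nodes toggled
    toggle³-∈ {(G , a) , b} t∈ =
      let p∈ , b∈    = ∈-pairs⁻ flags t∈
          isG , sat  = flag p∈
          b≢a , eq   = proj₂ (∈-filter⁻ (free? (G , a)) {xs = allFin (2 * n)} b∈)
      in ∈-pairs⁺
        (∈-cartesianProduct⁺ (∈-graphs (toggle-isGraph {G = G} b≢a isG)) (∈-allFin a))
        (∈-filter⁺ (toggled? (toggle a b G , a)) (∈-allFin b)
          ( b≢a
          , trans (adj-toggle-self a b G) (cong not eq)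
          -- Toggling again gives back `G`, where `a` satisfies `φ`.
          , subst (_⊨ φ [ a ∷ [] ]) (sym (toggle-involutive a b G)) sat))

    into : map toggle³ (pairs flags free) ⊆ pairs nodes toggled
    into t∈ =
      let _ , s∈ , eq = ∈-map⁻ toggle³ t∈
      in subst (_∈ pairs nodes toggled) (sym eq) (toggle³-∈ s∈)

-- From the count to the limit

-- A positive rational is at least the reciprocal of its denominator, so it suffices to bring
-- `x / w` below that reciprocal. The last two clauses discard a nonpositive `ε`.
∣/∣< : ∀ x w .{{_ : NonZero w}} ε → 0ℚ <ℚ ε → x * ↧ₙ ε < w → ∣ + x / w - 0ℚ ∣ <ℚ ε
∣/∣< x w@(suc w-1) ε@(mkℚ (+ suc p) d-1 _) _ xd<w =
  subst (_<ℚ ε) (sym abs≡) (ℚ.toℚᵘ-cancel-<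
    (ℚᵘ.<-respˡ-≃ (ℚᵘ.≃-sym (ℚ.toℚᵘ-fromℚᵘ (mkℚᵘ (+ x) w-1)))
      (*<* (subst₂ _<ℤ_ (pos-* x (suc d-1)) (pos-* (suc p) w) (+<+ x*d<p*w)))))
  where
  x*d<p*w : x * suc d-1 < suc p * w
  x*d<p*w = ≤-trans xd<w (m≤m+n w (p * w))

  abs≡ : ∣ + x / w - 0ℚ ∣ ≡ + x / w
  abs≡ = trans (cong ∣_∣ (ℚ.+-identityʳ (+ x / w)))
    (ℚ.0≤p⇒∣p∣≡p (ℚ.nonNegative⁻¹ (+ x / w) {{ℚ.normalize-nonNeg x w}}))
∣/∣< x w (mkℚ (+ zero)    _ _) (*<*ℚ (+<+ ())) _
∣/∣< x w (mkℚ -[1+ _ ] _ _) (*<*ℚ ()) _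

-- For positive `x`, the extra 1 in `suc (q * c)` makes the inequality strict before `c` is
-- cancelled. For `x = 0` strictness comes from `w` being nonzero.
x*q<w : ∀ x q w c .{{_ : NonZero w}} → x * suc (q * c) ≤ w * c → x * q < w
x*q<w zero    q (suc w) c _ = z<s
x*q<w (suc x) q w       c h = *-cancelʳ-< c _ _ (begin-strict
  suc x * q * c           <⟨ s≤s (m≤n+m _ x) ⟩
  suc x + suc x * q * c   ≡⟨ solve 3 (λ x q c → x :+ x :* q :* c := x :* (con 1 :+ q :* c)) refl (suc x) q c ⟩
  suc x * suc (q * c)     ≤⟨ h ⟩
  w * c                   ∎)
  where
  open ≤-Reasoning
  open +-*-Solver

sparse⇒regular : ∀ v k φ → Sparse v k φ → Regular φ
sparse⇒regular v k φ sparse ε ε>0 = N , λ n n≥N →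
  let instance
        W≢0 = graphs-nonZero (2 * n)
        n≢0 = >-nonZero (≤-trans (s≤s z≤n) n≥N)
  in ∣/∣< (length (ntr φ n)) (length (graphs (2 * n))) ε ε>0
       (x*q<w (length (ntr φ n)) q (length (graphs (2 * n))) c (*-cancelˡ-≤ n (bound n n≥N)))
  where
  q c N : ℕ
  q = ↧ₙ ε
  -- The constant left on the right of `double-count` after `n` is cancelled.
  c = 2 * suc k
  -- From here on at least `suc (q * c)` nodes are free, a fixed number that already beats `ε`.
  N = suc k + suc (q * c)

  bound : ∀ n → N ≤ n →
    n * (length (ntr φ n) * suc (q * c)) ≤ n * (length (graphs (2 * n)) * c)
  bound n n≥N = begin
    n * (X * m)              ≡⟨ solve 3 (λ n x m → n :* (x :* m) := x :* n :* m) refl n X m ⟩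
    -- The requirement is on `2 * n` nodes, and `N ≤ n` is more than enough.
    X * n * m                ≤⟨ double-count {v} {k} {φ} sparse n (≤-trans n≥N (m≤m+n n (n + 0))) ⟩
    W * (2 * n) * suc k      ≡⟨ solve 3 (λ n w k → w :* (con 2 :* n) :* k := n :* (w :* (con 2 :* k))) refl n W (suc k) ⟩
    n * (W * c)              ∎
    where
    open ≤-Reasoning
    open +-*-Solver
    X = length (ntr φ n)
    W = length (graphs (2 * n))
    m = suc (q * c)

-- Sparseness of the three properties

≡true⇒T : ∀ {x} → x ≡ true → T x
≡true⇒T = Equivalence.from T-≡

none-sparse : Sparse false 0 φ-none
none-sparse G a sat = [] , z≤n , λ {b} _ eq → contradiction (≡true⇒T eq) (sat b)

all-sparse : Sparse true 0 φ-all
all-sparse G a sat = [] , z≤n , λ {b} b≢a eq → ⊥-elim (subst T eq (sat b b≢a))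

-- `∃^` places each new quantifier innermost, at index 0, so its witness goes to the front of those
-- already found.
⊨-∃^ : ∀ k {m n} {G : Structure n} {φ : Formula (k + m)} {ρ} →
       G ⊨ ∃^ k φ [ ρ ] → ∃[ ys ] (G ⊨ φ [ ys ++ᵛ ρ ])
⊨-∃^ zero    sat = [] , sat
⊨-∃^ (suc k) sat with ys , y , sat′ ← ⊨-∃^ k sat = y ∷ ys , sat′

⊨-⋁ : ∀ {k m n} {G : Structure n} (f : Fin k → Formula m) {ρ} →
      G ⊨ ⋁ f [ ρ ] → ∃[ i ] (G ⊨ f i [ ρ ])
⊨-⋁ {suc k} f (inj₁ sat) = zero , sat
⊨-⋁ {suc k} f (inj₂ sat) with i , sat′ ← ⊨-⋁ (f ∘ suc) sat = suc i , sat′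

-- The witnesses of the existential block serve as the list of exceptions: the universal clause puts
-- every neighbour of `a` among them.
exactly-sparse : ∀ k → Sparse false k (φ-exactly k)
exactly-sparse k G a sat with ⊨-∃^ k sat
... | ys , _ , _ , only = toList ys , ≤-reflexive (Vec.length-toList ys) , in-ys
  where
  in-ys : ∀ {b} → b ≢ a → adj G a b ≡ true → b ∈ toList ys
  in-ys {b} _ eq with ⊨-⋁ _ (only b edge)
    where
    edge : Edge G (lookup (ys ++ᵛ a ∷ []) (k ↑ʳ zero)) b
    -- The index of `x` lies just past the `k` witnesses, where the environment holds `a`.
    edge = subst (λ x → Edge G x b) (sym (Vec.lookup-++ʳ ys (a ∷ []) zero)) (≡true⇒T eq)
  ... | i , b≡ = subst (_∈ toList ys) (sym (trans b≡ (Vec.lookup-++ˡ ys (a ∷ []) i))) (∈-toList⁺ (∈-lookup i ys))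

corollary6p3 : Regular φ-none × Regular φ-all × (∀ (k : ℕ) → 1 ≤ k → Regular (φ-exactly k))
corollary6p3 =
  sparse⇒regular false 0 φ-none none-sparse ,
  sparse⇒regular true 0 φ-all all-sparse ,
  λ k _ → sparse⇒regular false k (φ-exactly k) (exactly-sparse k)
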